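{- Let $p\ge 1$ be a constant integer. There is no $p$-pass streaming algorithm with a single output pass which uses $o(N)$ bits of space on inputs of length $N$ and which solves Sliding-Majority for all window sizes $K$.
   Context: Problem. The input is an array $A_0,\dots,A_{N-1}$ of bits together with a window size $K\le N$. Sliding-Majority asks for, for every $i\in\{0,\dots,N-K\}$, the majority bit of $A_i,\dots,A_{i+K-1}$, i.e. the bit that occurs more than $K/2$ times (for even $K$, ties are broken by any fixed convention). $p$-pass streaming model. Algorithms are exact and deterministic: they must give the correct output on every input. The algorithm knows $N,K$ in advance. The input is accessed only through $p$ sequential left-to-right scans (input passes). The $N-K+1$ answers are written to a write-only output stream, each exactly once. A single output pass means that, over the whole execution, the answers are written in the order of increasing window index $i=0,1,\dots,N-K$. Output need not be synchronized with the input position: at any time the algorithm may write any number of answers. Space is the maximum number of bits of working memory kept while scanning the input (so with space $M$ there are at most $2^M$ memory states); input and output streams are not counted. Space $o(N)$ means that the maximum of the space used over all window sizes $K$, as a function of $N$, is $o(N)$. -}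

module Defs where

open import Data.Bool.Base using (Bool; true; false; if_then_else_)
open import Data.Bool.Properties using (_≟_)
open import Data.Fin.Base using (Fin; zero; suc)
open import Data.List.Base using (List; []; _++_; length; filter; map; take; drop; upTo; applyUpTo)
open import Data.List.Extrema.Nat using (max)
open import Data.Nat.Base using (ℕ; zero; suc; _+_; _*_; _∸_; _≤_; _<ᵇ_)
open import Data.Product.Base using (_×_; _,_; ∃-syntax)
open import Data.Vec.Base using (Vec; []; _∷_; toList)
open import Function.Base using (_∘_)
open import Relation.Binary.PropositionalEquality using (_≡_)

-- A convention for ties may be any fixed function of the window's contents,
-- e.g. a constant bit or the first bit of the window.
TieBreak : Set
TieBreak = List Bool → Bool

occurrences : Bool → List Bool → ℕ
occurrences b w = length (filter (b ≟_) w)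

majority : TieBreak → List Bool → Bool
majority tie w =
  if length w <ᵇ 2 * occurrences true w then true
  else if length w <ᵇ 2 * occurrences false w then false
  else tie w

window : ∀ {N} → Vec Bool N → (K i : ℕ) → List Bool
window A K i = take K (drop i (toList A))

slidingMajority : ∀ {N} → TieBreak → (K : ℕ) → Vec Bool N → List Bool
slidingMajority {N} tie K A = map (majority tie ∘ window A K) (upTo (suc (N ∸ K)))

Memory : ℕ → Set
Memory M = Vec Bool M

-- What is done on reading one input bit: update the memory and append finitely
-- many answers (possibly none) to the output stream.  Internal computation
-- between two reads is not restricted.
Step : ℕ → Set
Step M = Memory M → Bool → Memory M × List Bool

-- A p-pass algorithm for fixed N and K.  The step may depend on the number of
-- the current pass and on the current position in the input without storing
-- either in memory.  An algorithm that keeps these counters itself is a special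
-- case, and so is one that also writes answers before, between or after passes:
-- such answers can be attached to the first or last step of a pass.
record Program (p N M : ℕ) : Set where
  field
    initial : Memory M
    step    : Fin p → Fin N → Step M

scan : ∀ {N M} → (Fin N → Step M) → Vec Bool N → Memory M → Memory M × List Bool
scan δ []      s = s , []
scan δ (b ∷ A) s =
  let s₁ , out₁ = δ zero s b
      s₂ , out₂ = scan (δ ∘ suc) A s₁
  in  s₂ , out₁ ++ out₂

scans : ∀ {p N M} → (Fin p → Fin N → Step M) → Vec Bool N → Memory M → List Bool
scans {zero}  δ A s = []
scans {suc p} δ A s =
  let s₁ , out₁ = scan (δ zero) A s
  in  out₁ ++ scans (δ ∘ suc) A s₁

-- The whole output stream, in the order of writing.
run : ∀ {p N M} → Program p N M → Vec Bool N → List Bool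
run P A = scans (Program.step P) A (Program.initial P)

-- N and K are known in advance, so the program may depend on both.
record StreamingAlgorithm (p : ℕ) : Set where
  field
    space   : (N K : ℕ) → ℕ
    program : (N K : ℕ) → Program p N (space N K)

  -- Maximum over the window sizes K = 1, …, N.
  maxSpace : ℕ → ℕ
  maxSpace N = max 0 (applyUpTo (λ k → space N (suc k)) N)

open StreamingAlgorithm public

-- Equality of the lists expresses the single output pass: every answer is
-- written exactly once, in the order of increasing window index.
SolvesSlidingMajority : ∀ {p} → TieBreak → StreamingAlgorithm p → Set
SolvesSlidingMajority tie 𝒜 =
  ∀ N K → 1 ≤ K → K ≤ N → (A : Vec Bool N) →
  run (program 𝒜 N K) A ≡ slidingMajority tie K A

-- f(N) = o(N), with ε ranging over 1/c.
Is-o[N] : (ℕ → ℕ) → Set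
Is-o[N] f = ∀ c → 1 ≤ c → ∃[ N₀ ] (∀ N → N₀ ≤ N → c * f N ≤ N)

{-# OPTIONS --safe #-}
module Submission where

-- A fooling-set argument.  Let N = 4 L + 1 and K = 2 L + 1, and for x, y in
-- {0,1}^L consider the input code(x) 1 code(y), where each bit b is coded as
-- b (1 - b).  The window starting at an even position contains one more true
-- than false; the one starting at position 2 j + 1 has true majority iff
-- x_j ≤ y_j.  Hence all answers are true iff x ≤ y pointwise, in particular on
-- the diagonal x = y.  If the diagonal inputs of x and y produce the same memory
-- states whenever the scan crosses from code(x) to 1 code(y) or reaches the end
-- of a pass, then on the crossed inputs (x, y) and (y, x) only true is ever
-- written, so x ≤ y ≤ x.  The 2 p M bits of these states thus determine x, and
-- L ≤ 2 p M.

open import Defs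
open import Data.Bool.Base using (Bool; true; false; not; b≤b; f≤t)
import Data.Bool.Base as Bool
import Data.Bool.Properties as Bool
open import Data.Fin.Base using (Fin; zero; suc; _↑ˡ_; _↑ʳ_)
open import Data.Fin.Properties using (2↔Bool; *↔×; injective⇒≤)
open import Data.List.Base as List using (List; []; _∷_; _++_; length; take; drop)
open import Data.List.Extrema.Nat using (xs≤max)
open import Data.List.Properties using (++-assoc; filter-++; length-++)
open import Data.List.Relation.Unary.All using (All)
open import Data.List.Relation.Unary.All.Properties
  using (++⁺; ++⁻ˡ; ++⁻ʳ; map⁺; map⁻; applyUpTo⁺₁; applyUpTo⁻)
open import Data.Nat.Base
open import Data.Nat.Properties
open import Data.Nat.Tactic.RingSolver using (solve-∀)
open import Data.Product.Base using (_×_; _,_; proj₁; proj₂; ∃-syntax; uncurry)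
open import Data.Product.Function.NonDependent.Propositional using (_×-↔_)
open import Data.Unit.Base using (tt)
open import Data.Vec.Base as Vec using (Vec; []; _∷_; toList; uncons)
open import Data.Vec.Properties using (++-injective; toList-++)
open import Data.Vec.Relation.Binary.Pointwise.Inductive as Pointwise
  using (Pointwise; []; _∷_)
open import Function.Base using (_∘_; id)
open import Function.Bundles using (_↔_; mk↔ₛ′; module Inverse; module Injection)
open import Function.Construct.Composition using (_↔-∘_)
open import Function.Construct.Symmetry using (↔-sym)
open import Function.Definitions using (Injective)
open import Function.Properties.Inverse using (↔⇒↣)
open import Relation.Binary.PropositionalEquality
open import Relation.Nullary.Negation.Core using (¬_; contradiction)
open import Relation.Unary using (Pred)

private
  variable
    m n p M : ℕ

-- Pigeonhole for bit vectors.

bitVectors↔Fin : ∀ n → Vec Bool n ↔ Fin (2 ^ n)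
bitVectors↔Fin zero    =
  mk↔ₛ′ (λ _ → zero) (λ _ → []) (λ { zero → refl }) (λ { [] → refl })
bitVectors↔Fin (suc n) =
  ↔-sym (*↔× {2}) ↔-∘ ((↔-sym 2↔Bool ×-↔ bitVectors↔Fin n) ↔-∘ uncons↔)
  where
  uncons↔ : Vec Bool (suc n) ↔ (Bool × Vec Bool n)
  uncons↔ = mk↔ₛ′ uncons (uncurry _∷_) (λ _ → refl) (λ { (_ ∷ _) → refl })

-- If `n < m`, then `2 ^ n < 2 ^ m`, and `f` conjugated by the bijections would inject the larger
-- finite set into the smaller.
bitVectors-injective⇒≤ : {f : Vec Bool m → Vec Bool n} → Injective _≡_ _≡_ f → m ≤ n
bitVectors-injective⇒≤ {m} {n} {f} f-inj = ≮⇒≥ λ n<m →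
  ≤⇒≯ (injective⇒≤ {f = to (bitVectors↔Fin n) ∘ f ∘ from (bitVectors↔Fin m)}
        (Injection.injective (↔⇒↣ (↔-sym (bitVectors↔Fin m)))
          ∘ f-inj ∘ Injection.injective (↔⇒↣ (bitVectors↔Fin n))))
      (^-monoʳ-< 2 (s≤s (s≤s z≤n)) n<m)
  where open Inverse using (to; from)

-- Cutting each pass at the crossing.

scan-++ : (δ : Fin (m + n) → Step M) (U : Vec Bool m) (V : Vec Bool n) (s : Memory M) →
  scan δ (U Vec.++ V) s ≡
    (let t , out₁ = scan (δ ∘ (_↑ˡ n)) U s
         r , out₂ = scan (δ ∘ (m ↑ʳ_)) V t
     in  r , out₁ ++ out₂)
scan-++ δ []      V s = refl
scan-++ δ (b ∷ U) V s
  rewrite scan-++ (δ ∘ suc) U V (proj₁ (δ zero s b)) =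
  cong₂ _,_ refl (sym (++-assoc (proj₂ (δ zero s b)) _ _))

-- Each pass contributes its state at the crossing and its final state, from which the next pass
-- resumes. Packing them into one bit vector makes the pigeonhole bound applicable.
transcript : (Fin p → Fin (m + n) → Step M) → Vec Bool m → Vec Bool n → Memory M →
             Vec Bool (p * (M + M))
transcript {zero}          δ U V s = []
transcript {suc p} {m} {n} δ U V s =
  let t = proj₁ (scan (δ zero ∘ (_↑ˡ n)) U s)
      r = proj₁ (scan (δ zero ∘ (m ↑ʳ_)) V t)
  in  (t Vec.++ r) Vec.++ transcript (δ ∘ suc) U V r

-- With equal transcripts, the run on U and V′ behaves on U as the run on U and V,
-- and on V′ as the run on U′ and V′.
scans-crossing : ∀ {ℓ} {P : Pred Bool ℓ} (δ : Fin p → Fin (m + n) → Step M)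
  (U U′ : Vec Bool m) (V V′ : Vec Bool n) (s : Memory M) →
  transcript δ U V s ≡ transcript δ U′ V′ s →
  All P (scans δ (U Vec.++ V) s) → All P (scans δ (U′ Vec.++ V′) s) →
  All P (scans δ (U Vec.++ V′) s)
scans-crossing {zero} δ U U′ V V′ s eq all all′ = all
scans-crossing {suc p} {m} {n} δ U U′ V V′ s eq all all′
  rewrite scan-++ (δ zero) U V s | scan-++ (δ zero) U′ V′ s | scan-++ (δ zero) U V′ s
  with t , o ← scan (δ zero ∘ (_↑ˡ n)) U s
     | t′ , o′ ← scan (δ zero ∘ (_↑ˡ n)) U′ s
  with states , rest ← ++-injective (t Vec.++ _) (t′ Vec.++ _) eq
  -- Identifying `t` with `t′` before the second halves are scanned makes the crossed run read `V′`
  -- from the same state as the run on `U′` and `V′`. It thus writes `o` and then `q′`, and `r≡r′`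
  -- lets the next pass start alike.
  with refl , r≡r′ ← ++-injective t t′ states
  with r , q ← scan (δ zero ∘ (m ↑ʳ_)) V t
     | r′ , q′ ← scan (δ zero ∘ (m ↑ʳ_)) V′ t
  with refl ← r≡r′ =
  ++⁺ (++⁺ (++⁻ˡ o (++⁻ˡ (o ++ q) all)) (++⁻ʳ o′ (++⁻ˡ (o′ ++ q′) all′)))
      (scans-crossing (δ ∘ suc) U U′ V V′ r rest
        (++⁻ʳ (o ++ q) all) (++⁻ʳ (o′ ++ q′) all′))

-- Counting bits to decide the majority.

occurrences-++ : ∀ b (u v : List Bool) →
  occurrences b (u ++ v) ≡ occurrences b u + occurrences b v
occurrences-++ b u v =
  trans (cong length (filter-++ (b Bool.≟_) u v)) (length-++ (List.filter (b Bool.≟_) u))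

occurrences-total : ∀ w → length w ≡ occurrences true w + occurrences false w
occurrences-total []          = refl
occurrences-total (true ∷ w)  = cong suc (occurrences-total w)
occurrences-total (false ∷ w) =
  trans (cong suc (occurrences-total w)) (sym (+-suc (occurrences true w) _))

-- The length is the sum of both counts, so the test against twice the count of `true` reduces to
-- comparing the counts.
majority-true : ∀ tie w → occurrences false w < occurrences true w → majority tie w ≡ true
majority-true tie w f<t
  rewrite occurrences-total w | +-identityʳ (occurrences true w)
  with occurrences true w + occurrences false w <ᵇ occurrences true w + occurrences true w
     | <⇒<ᵇ (+-monoʳ-< (occurrences true w) f<t)
... | true | _ = refl

majority-false : ∀ tie w → occurrences true w < occurrences false w → majority tie w ≡ false
majority-false tie w t<f
  rewrite occurrences-total w | +-identityʳ (occurrences true w) | +-identityʳ (occurrences false w)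
  with occurrences true w + occurrences false w <ᵇ occurrences true w + occurrences true w
     | <ᵇ⇒< (occurrences true w + occurrences false w) (occurrences true w + occurrences true w)
... | true | lt = contradiction (+-cancelˡ-< (occurrences true w) _ _ (lt tt)) (<-asym t<f)
... | false | _
  with occurrences true w + occurrences false w <ᵇ occurrences false w + occurrences false w
     | <⇒<ᵇ (+-monoˡ-< (occurrences false w) t<f)
... | true | _ = refl

-- Balanced codes and sliding windows.

encode : Vec Bool n → Vec Bool (n * 2)
encode []      = []
encode (b ∷ x) = b ∷ not b ∷ encode x

code : Vec Bool n → List Bool
code = toList ∘ encode

length-code : (x : Vec Bool n) → length (code x) ≡ n * 2
length-code []      = refl
length-code (b ∷ x) = cong (2 +_) (length-code x)

occurrences-code : ∀ c (x : Vec Bool n) → occurrences c (code x) ≡ n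
occurrences-code c     []          = refl
occurrences-code true  (true ∷ x)  = cong suc (occurrences-code true x)
occurrences-code true  (false ∷ x) = cong suc (occurrences-code true x)
occurrences-code false (true ∷ x)  = cong suc (occurrences-code false x)
occurrences-code false (false ∷ x) = cong suc (occurrences-code false x)

take-length-++ : ∀ {a} {A : Set a} (u v : List A) → take (length u) (u ++ v) ≡ u
take-length-++ []      v = refl
take-length-++ (a ∷ u) v = cong (a ∷_) (take-length-++ u v)

-- A code is balanced, adding `n` to either count, so only the end bits and `mid` can tip the
-- majority. Windows at odd positions have this shape.
occurrences-block : ∀ c b b′ (x : Vec Bool n) mid →
  occurrences c (b ∷ (code x ++ mid) ++ b′ ∷ []) ≡
  occurrences c (b ∷ b′ ∷ []) + (n + occurrences c mid)
occurrences-block {n} c b b′ x mid = begin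
  occ (b ∷ (code x ++ mid) ++ b′ ∷ [])
    ≡⟨ occurrences-++ c (b ∷ code x ++ mid) (b′ ∷ []) ⟩
  occ (b ∷ code x ++ mid) + occ (b′ ∷ [])
    ≡⟨ cong (_+ occ (b′ ∷ [])) (occurrences-++ c (b ∷ []) (code x ++ mid)) ⟩
  occ (b ∷ []) + occ (code x ++ mid) + occ (b′ ∷ [])
    ≡⟨ cong (λ k → occ (b ∷ []) + k + occ (b′ ∷ []))
            (trans (occurrences-++ c (code x) mid) (cong (_+ occ mid) (occurrences-code c x))) ⟩
  occ (b ∷ []) + (n + occ mid) + occ (b′ ∷ [])
    ≡⟨ swap (occ (b ∷ [])) (n + occ mid) (occ (b′ ∷ [])) ⟩
  occ (b ∷ []) + occ (b′ ∷ []) + (n + occ mid)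
    ≡⟨ cong (_+ (n + occ mid)) (occurrences-++ c (b ∷ []) (b′ ∷ [])) ⟨
  occ (b ∷ b′ ∷ []) + (n + occ mid) ∎
  where
  open ≡-Reasoning
  occ = occurrences c
  swap : ∀ i j k → i + j + k ≡ i + k + j
  swap = solve-∀

-- The window slides through the blocks of x and y in parallel; mid is the central
-- true followed by the blocks of y that are already inside the window.
module _ (tie : TieBreak) where

  AllTrue : ℕ → (x y : Vec Bool n) → List Bool → Set
  AllTrue {n} K x y mid = ∀ i → i ≤ n * 2 →
    majority tie (take K (drop i (code x ++ mid ++ code y))) ≡ true

  -- The invariant of the sliding: the lone central `true` satisfies it, and every block entering
  -- `mid` is balanced.
  Surplus : List Bool → Set
  Surplus w = occurrences true w ≡ suc (occurrences false w)

  surplus-snoc : ∀ b mid → Surplus mid → Surplus (mid ++ b ∷ not b ∷ [])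
  surplus-snoc b mid s
    rewrite occurrences-++ true mid (b ∷ not b ∷ [])
          | occurrences-++ false mid (b ∷ not b ∷ []) | s = block b
    where
    block : ∀ b → suc (occurrences false mid + occurrences true (b ∷ not b ∷ [])) ≡
                  suc (occurrences false mid + occurrences false (b ∷ not b ∷ []))
    block true  = refl
    block false = refl

  window-aligned : ∀ K (x : Vec Bool n) mid rest → K ≡ n * 2 + length mid → Surplus mid →
    majority tie (take K (code x ++ mid ++ rest)) ≡ true
  window-aligned {n} K x mid rest K≡ s = begin
    majority tie (take K (code x ++ mid ++ rest))
      ≡⟨ cong₂ (λ k l → majority tie (take k l))
           (trans K≡ (sym (trans (length-++ (code x)) (cong (_+ length mid) (length-code x)))))
           (sym (++-assoc (code x) mid rest)) ⟩
    majority tie (take (length (code x ++ mid)) ((code x ++ mid) ++ rest))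
      ≡⟨ cong (majority tie) (take-length-++ (code x ++ mid) rest) ⟩
    majority tie (code x ++ mid)
      ≡⟨ majority-true tie (code x ++ mid) more ⟩
    true ∎
    where
    open ≡-Reasoning
    more : occurrences false (code x ++ mid) < occurrences true (code x ++ mid)
    more rewrite occurrences-++ true (code x) mid | occurrences-++ false (code x) mid
               | occurrences-code true x | occurrences-code false x | s =
      ≤-reflexive (sym (+-suc n _))

  -- In the application, `b` is the second bit of the block of `x` being left and `b′` the first bit
  -- of the block of `y` being entered.
  window-shifted : ∀ K b b′ (x : Vec Bool n) mid rest →
    K ≡ suc n * 2 + length mid →
    take K (b ∷ code x ++ mid ++ b′ ∷ rest) ≡ b ∷ (code x ++ mid) ++ b′ ∷ []
  window-shifted {n} K b b′ x mid rest K≡ = begin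
    take K (b ∷ code x ++ mid ++ b′ ∷ rest)
      ≡⟨ cong₂ take (trans K≡ (sym size)) regroup ⟩
    take (length w) (w ++ rest)
      ≡⟨ take-length-++ w rest ⟩
    w ∎
    where
    open ≡-Reasoning
    w = b ∷ (code x ++ mid) ++ b′ ∷ []
    size : length w ≡ suc n * 2 + length mid
    size = trans (cong suc (trans (length-++ (code x ++ mid)) (+-comm _ 1)))
      (cong (2 +_) (trans (length-++ (code x)) (cong (_+ length mid) (length-code x))))
    regroup : b ∷ code x ++ mid ++ b′ ∷ rest ≡ w ++ rest
    regroup = cong (b ∷_) (trans (sym (++-assoc (code x) mid (b′ ∷ rest)))
      (sym (++-assoc (code x ++ mid) (b′ ∷ []) rest)))

  -- If `b` equals `b′`, the end bits cancel and the lead of one from `mid` remains; otherwise both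
  -- are `true` and the lead is three.
  window-shifted-≤ : ∀ {b b′} (x : Vec Bool n) mid → Surplus mid → b Bool.≤ b′ →
    majority tie (not b ∷ (code x ++ mid) ++ b′ ∷ []) ≡ true
  window-shifted-≤ {n} {b} {b′} x mid s b≤b′ =
    majority-true tie (not b ∷ (code x ++ mid) ++ b′ ∷ []) (more b≤b′)
    where
    more : ∀ {b b′} → b Bool.≤ b′ →
      occurrences false (not b ∷ (code x ++ mid) ++ b′ ∷ []) <
      occurrences true (not b ∷ (code x ++ mid) ++ b′ ∷ [])
    more {b} {b′} b≤b′ rewrite occurrences-block true (not b) b′ x mid
      | occurrences-block false (not b) b′ x mid | s | +-suc n (occurrences false mid)
      with b≤b′
    ... | f≤t = m≤n+m _ 2
    more {true}  _ | b≤b = ≤-refl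
    more {false} _ | b≤b = ≤-refl

  -- The end bits for `b = true` and `b′ = false`: together they turn the lead of one into a deficit
  -- of one.
  window-shifted-≰ : (x : Vec Bool n) → ∀ mid → Surplus mid →
    majority tie (false ∷ (code x ++ mid) ++ false ∷ []) ≡ false
  window-shifted-≰ {n} x mid s =
    majority-false tie (false ∷ (code x ++ mid) ++ false ∷ []) fewer
    where
    fewer : occurrences true (false ∷ (code x ++ mid) ++ false ∷ []) <
            occurrences false (false ∷ (code x ++ mid) ++ false ∷ [])
    fewer rewrite occurrences-block true false false x mid
      | occurrences-block false false false x mid | s | +-suc n (occurrences false mid) = ≤-refl

  advance : ∀ K b (x y : Vec Bool n) mid i →
    take K (drop i (code x ++ mid ++ code (b ∷ y))) ≡
    take K (drop i (code x ++ (mid ++ b ∷ not b ∷ []) ++ code y))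
  advance K b x y mid i = cong (λ l → take K (drop i (code x ++ l)))
    (sym (++-assoc mid (b ∷ not b ∷ []) (code y)))

  length-advance : ∀ {K} n b mid → K ≡ suc n * 2 + length mid →
    K ≡ n * 2 + length (mid ++ b ∷ not b ∷ [])
  length-advance n b mid K≡ = trans K≡
    (trans (shift (n * 2) (length mid)) (cong (n * 2 +_) (sym (length-++ mid))))
    where
    shift : ∀ i j → 2 + i + j ≡ i + (j + 2)
    shift = solve-∀

  -- Induction along the blocks: `x` loses its first block while `mid` gains one from `y`, so the
  -- same `K` still fits.
  allTrue⁺ : ∀ {K} {x y : Vec Bool n} mid → K ≡ n * 2 + length mid → Surplus mid →
    Pointwise Bool._≤_ x y → AllTrue K x y mid
  allTrue⁺ {x = x} {y} mid K≡ s _ zero _ = window-aligned _ x mid (code y) K≡ s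
  allTrue⁺ {x = _ ∷ x} {b′ ∷ _} mid K≡ s (b≤b′ ∷ _) 1 _ =
    trans (cong (majority tie) (window-shifted _ _ b′ x mid _ K≡))
          (window-shifted-≤ x mid s b≤b′)
  -- Dropping two positions computes past the first block of `x`, so `advance` only has to
  -- reassociate.
  allTrue⁺ {suc n} {K} {_ ∷ x} {b′ ∷ y} mid K≡ s (_ ∷ x≤y) (suc (suc i)) (s≤s (s≤s i≤)) =
    trans (cong (majority tie) (advance K b′ x y mid i))
      (allTrue⁺ (mid ++ b′ ∷ not b′ ∷ []) (length-advance n b′ mid K≡) (surplus-snoc b′ mid s) x≤y i i≤)

  -- Window 1 decides the comparison of the first coordinates; the windows from 2 on are those of
  -- the tails.
  allTrue⁻ : ∀ {K} (x y : Vec Bool n) mid → K ≡ n * 2 + length mid → Surplus mid →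
    AllTrue K x y mid → Pointwise Bool._≤_ x y
  allTrue⁻ [] [] mid K≡ s all = []
  allTrue⁻ {suc n} {K} (b ∷ x) (b′ ∷ y) mid K≡ s all =
    head b b′ (trans (sym (cong (majority tie) (window-shifted K (not b) b′ x mid _ K≡)))
                (all 1 (s≤s z≤n)))
    ∷ allTrue⁻ x y (mid ++ b′ ∷ not b′ ∷ []) (length-advance n b′ mid K≡) (surplus-snoc b′ mid s)
        (λ i i≤ → trans (sym (cong (majority tie) (advance K b′ x y mid i)))
                        (all (2 + i) (s≤s (s≤s i≤))))
    where
    head : ∀ b b′ → majority tie (not b ∷ (code x ++ mid) ++ b′ ∷ []) ≡ true → b Bool.≤ b′
    head false false _ = b≤b
    head false true  _ = f≤t
    head true  true  _ = b≤b
    head true  false e with () ← trans (sym (window-shifted-≰ x mid s)) e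

  -- Hard inputs and the space bound.

  hardInput : Vec Bool n → Vec Bool n → Vec Bool (n * 2 + suc (n * 2))
  hardInput x y = encode x Vec.++ true ∷ encode y

  AllAnswersTrue : Vec Bool n → Vec Bool n → Set
  AllAnswersTrue {n} x y =
    All (_≡ true) (slidingMajority tie (suc (n * 2)) (hardInput x y))

  private
    toList-hardInput : (x y : Vec Bool n) →
      toList (hardInput x y) ≡ code x ++ (true ∷ []) ++ code y
    toList-hardInput x y = toList-++ (encode x) (true ∷ encode y)

    windows : ∀ n → n * 2 + suc (n * 2) ∸ suc (n * 2) ≡ n * 2
    windows n = m+n∸n≡m (n * 2) (suc (n * 2))

  answersTrue⁺ : {x y : Vec Bool n} → Pointwise Bool._≤_ x y → AllAnswersTrue x y
  answersTrue⁺ {n} {x} {y} x≤y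
    rewrite windows n | toList-hardInput x y =
    map⁺ (applyUpTo⁺₁ id (suc (n * 2)) λ {i} i< →
      allTrue⁺ (true ∷ []) (+-comm 1 (n * 2)) refl x≤y i (s≤s⁻¹ i<))

  answersTrue⁻ : {x y : Vec Bool n} → AllAnswersTrue x y → Pointwise Bool._≤_ x y
  answersTrue⁻ {n} {x} {y} all
    rewrite windows n | toList-hardInput x y =
    allTrue⁻ x y (true ∷ []) (+-comm 1 (n * 2)) refl λ i i≤ →
      applyUpTo⁻ id (suc (n * 2)) (map⁻ all) (s≤s i≤)

  space-lowerBound : (P : Program p (n * 2 + suc (n * 2)) M) →
    (∀ A → run P A ≡ slidingMajority tie (suc (n * 2)) A) → n ≤ p * (M + M)
  space-lowerBound {p} {n} {M} P correct = bitVectors-injective⇒≤ {f = t} λ {x} {y} eq →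
    Pointwise.Pointwise-≡⇒≡ (antisym (cross x y eq) (cross y x (sym eq)))
    where
    open Program P
    t : Vec Bool n → Vec Bool (p * (M + M))
    t x = transcript step (encode x) (true ∷ encode x) initial

    diagonal : ∀ x → All (_≡ true) (run P (hardInput x x))
    diagonal x = subst (All (_≡ true)) (sym (correct _))
      (answersTrue⁺ (Pointwise.refl Bool.≤-refl))

    cross : ∀ x y → t x ≡ t y → Pointwise Bool._≤_ x y
    cross x y eq = answersTrue⁻ (subst (All (_≡ true)) (correct _)
      (scans-crossing step (encode x) (encode y) _ _ initial eq (diagonal x) (diagonal y)))

    antisym : ∀ {k} {x y : Vec Bool k} →
      Pointwise Bool._≤_ x y → Pointwise Bool._≤_ y x → Pointwise _≡_ x y
    antisym []        []        = []
    antisym (b≤ ∷ x≤) (≤b ∷ ≤x) = Bool.≤-antisym b≤ ≤b ∷ antisym x≤ ≤x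

-- Contradiction with sublinear space.

space≤maxSpace : ∀ (𝒜 : StreamingAlgorithm p) N k → k < N → space 𝒜 N (suc k) ≤ maxSpace 𝒜 N
space≤maxSpace 𝒜 N k k<N =
  applyUpTo⁻ (λ k → space 𝒜 N (suc k)) N (xs≤max 0 _) k<N

-- Eight times the lower bound gives `8 * L ≤ 16 * p * S ≤ N`, but `N` equals `4 * L + 1`, which is
-- less than `8 * L` because `L` is positive.
no-linear-gap : ∀ {p N₀ S} → let L = suc N₀; N = L * 2 + suc (L * 2) in
  L ≤ p * (S + S) → ¬ (16 * p * S ≤ N)
no-linear-gap {p} {N₀} {S} L≤ ≤N = <-irrefl refl (begin-strict
  8 * L                ≤⟨ *-monoʳ-≤ 8 L≤ ⟩
  8 * (p * (S + S))    ≡⟨ regroup p S ⟩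
  16 * p * S           ≤⟨ ≤N ⟩
  N                    <⟨ m<m+n N z<s ⟩
  N + (3 + 4 * N₀)     ≡⟨ total N₀ ⟩
  8 * L                ∎)
  where
  open ≤-Reasoning
  L = suc N₀
  N = L * 2 + suc (L * 2)
  regroup : ∀ p s → 8 * (p * (s + s)) ≡ 16 * p * s
  regroup = solve-∀
  total : ∀ n → suc n * 2 + suc (suc n * 2) + (3 + 4 * n) ≡ 8 * suc n
  total = solve-∀

theorem6p4 : (p : ℕ) → 1 ≤ p → (tie : TieBreak) →
    ¬ (∃[ 𝒜 ] (SolvesSlidingMajority {p} tie 𝒜 × Is-o[N] (maxSpace 𝒜)))
theorem6p4 p 1≤p tie (𝒜 , solves , small) = no-linear-gap {p} {N₀} {space 𝒜 N K}
  (space-lowerBound tie {n = L} (program 𝒜 N K) (solves N K (s≤s z≤n) K≤N))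
  -- `K≤N` doubles as `L * 2 < N`, since `K` is `suc (L * 2)`.
  (≤-trans (*-monoʳ-≤ (16 * p) (space≤maxSpace 𝒜 N (L * 2) K≤N)) (proj₂ threshold N N₀≤N))
  where
  threshold : ∃[ N₀ ] (∀ N → N₀ ≤ N → 16 * p * maxSpace 𝒜 N ≤ N)
  -- The factor must be positive, which is where `1 ≤ p` enters.
  threshold = small (16 * p) (≤-trans 1≤p (m≤n*m p 16))
  N₀ = proj₁ threshold
  -- The successor makes `L` positive and still puts `N` beyond the threshold.
  L = suc N₀
  K = suc (L * 2)
  N = L * 2 + K
  K≤N : K ≤ N
  K≤N = m≤n+m K (L * 2)
  N₀≤N : N₀ ≤ N
  N₀≤N = ≤-trans (n≤1+n N₀) (≤-trans (m≤m*n L 2) (m≤m+n (L * 2) K))
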